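{- Let $G$ be a finite tree in which the distance between any two endpoints (vertices of degree $1$) is even. Then $\alpha(G) = \beta(G)$.
   Context: All graphs are finite, undirected, without loops or multiple edges. $V(G)$ and $E(G)$ denote the vertex and edge sets of a graph $G$. An endpoint is a vertex of degree $1$. A matching is a set of pairwise non-adjacent edges (no two share a vertex). For $X \subseteq E(G)$, a mapping $f : X \to \{0,1\}$ is called a partial $0$-$1$ coloring of $G$. For $i = 0,1$ put $f_i = \{e \in X : f(e) = i\}$. The coloring $f$ is proper if $f_0$ and $f_1$ are both matchings of $G$. Define $\lambda(G) = \max\{|f_0| + |f_1| : f \text{ is a proper partial } 0\text{ - }1 \text{ coloring of } G\}$. A proper partial $0$-$1$ coloring $f$ of $G$ is maximum (an MPP $0$-$1$ coloring) if $|f_0| + |f_1| = \lambda(G)$. Define $\alpha(G) = \max\{|f_i| : i = 0,1 \text{ and } f \text{ is an MPP } 0\text{ - }1 \text{ coloring of } G\}$. $\beta(G)$ denotes the cardinality of a maximum matching of $G$. -}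

module Defs where

open import Data.Bool.Base using (true; false)
open import Data.Empty using (⊥-elim)
open import Data.Fin.Base using (Fin; _<_)
open import Data.Fin.Patterns using (0F; 1F)
open import Data.Fin.Properties using (all?) renaming (_≟_ to _≟ᶠ_)
open import Data.Fin.Subset using (Subset; ∣_∣; _∈_; inside; outside; ⊥)
open import Data.Fin.Subset.Properties using (_∈?_; ∉⊥)
open import Data.List.Base using (List; []; _∷_; [_]; map; filter; allFin; cartesianProduct; cartesianProductWith)
open import Data.List.Extrema.Nat using (max; xs≤max; argmax-sel)
open import Data.List.Membership.Propositional using () renaming (_∈_ to _∈ˡ_)
open import Data.List.Membership.Propositional.Properties using (∈-cartesianProductWith⁺; ∈-cartesianProduct⁺; ∈-allFin; ∈-filter⁺; ∈-filter⁻; ∈-map⁺; ∈-map⁻)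
open import Data.List.Relation.Unary.All as All using ()
open import Data.List.Relation.Unary.Any using (here; there)
open import Data.List.Relation.Unary.Unique.Propositional using (Unique)
open import Data.Maybe.Base using (Maybe; just; nothing)
open import Data.Maybe.Properties using (≡-dec)
open import Data.Nat.Base using (ℕ; zero; suc; _+_; _≤_; z≤n)
import Data.Nat.Base as ℕ
import Data.Nat.Properties as ℕₚ
open import Data.Nat.Divisibility using (_∣_)
open import Data.Product.Base using (∃; _×_; _,_; proj₂)
open import Data.Sum.Base using (_⊎_; inj₁; inj₂)
open import Data.Vec.Base using (Vec; []; _∷_; tabulate; replicate)
import Data.Vec.Base as Vec
open import Relation.Binary.Construct.Closure.ReflexiveTransitive using (Star; ε; _◅_)
open import Relation.Binary.PropositionalEquality using (_≡_; _≢_; refl; sym; subst)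
open import Relation.Nullary using (¬_; Dec; does)
open import Relation.Nullary.Decidable using (_×-dec_; _⊎-dec_; _→-dec_; ¬?)
open import Relation.Unary using (Decidable)

-- A finite simple graph with n vertices and m edges.  An undirected edge is
-- stored as its ordered pair of ends, smaller end first: this excludes loops,
-- and injectivity excludes multiple edges.
record Graph (n m : ℕ) : Set where
  field
    lo hi     : Fin m → Fin n
    lo<hi     : ∀ e → lo e < hi e
    injective : ∀ {e e′} → lo e ≡ lo e′ → hi e ≡ hi e′ → e ≡ e′

module _ {n m : ℕ} (G : Graph n m) where
  open Graph G

  Incident : Fin n → Fin m → Set
  Incident v e = v ≡ lo e ⊎ v ≡ hi e

  incident? : ∀ v e → Dec (Incident v e)
  incident? v e = (v ≟ᶠ lo e) ⊎-dec (v ≟ᶠ hi e)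

  degree : Fin n → ℕ
  degree v = ∣ tabulate (λ e → does (incident? v e)) ∣

  Endpoint : Fin n → Set
  Endpoint v = degree v ≡ 1

  Adjacent : Fin n → Fin n → Set
  Adjacent u v = ∃ λ e → (lo e ≡ u × hi e ≡ v) ⊎ (lo e ≡ v × hi e ≡ u)

  Walk : Fin n → Fin n → Set
  Walk = Star Adjacent

  length : ∀ {u v} → Walk u v → ℕ
  length ε       = 0
  length (_ ◅ w) = suc (length w)

  -- The vertices visited by a walk, without the final one.
  sources : ∀ {u v} → Walk u v → List (Fin n)
  sources ε               = []
  sources {u = u} (_ ◅ w) = u ∷ sources w

  IsCycle : ∀ {u} → Walk u u → Set
  IsCycle w = 3 ≤ length w × Unique (sources w)

  -- A connected acyclic graph; the graph without vertices is not a tree.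
  record IsTree : Set where
    field
      nonempty  : 0 ℕ.< n
      connected : ∀ u v → Walk u v
      acyclic   : ∀ {u} (w : Walk u u) → ¬ IsCycle w

  IsDistance : Fin n → Fin n → ℕ → Set
  IsDistance u v d = (∃ λ (w : Walk u v) → length w ≡ d) × (∀ (w : Walk u v) → d ≤ length w)

  ShareVertex : Fin m → Fin m → Set
  ShareVertex e e′ = Incident (lo e) e′ ⊎ Incident (hi e) e′

  IsMatching : Subset m → Set
  IsMatching M = ∀ e e′ → e ∈ M → e′ ∈ M → e ≢ e′ → ¬ ShareVertex e e′

  isMatching? : Decidable IsMatching
  isMatching? M = all? λ e → all? λ e′ →
    (e ∈? M) →-dec (e′ ∈? M) →-dec ¬? (e ≟ᶠ e′) →-dec
    ¬? (incident? (lo e) e′ ⊎-dec incident? (hi e) e′)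

-- A partial 0-1 coloring f : X → {0,1} of m edges; X consists of the edges
-- whose entry is not  nothing.
Coloring : ℕ → Set
Coloring = Vec (Maybe (Fin 2))

class : ∀ {m} → Coloring m → Fin 2 → Subset m
class f i = Vec.map (λ c → does (≡-dec _≟ᶠ_ c (just i))) f

size : ∀ {m} → Coloring m → ℕ
size f = ∣ class f 0F ∣ + ∣ class f 1F ∣

vectors : {A : Set} → List A → ∀ m → List (Vec A m)
vectors xs zero    = [ [] ]
vectors xs (suc m) = cartesianProductWith _∷_ xs (vectors xs m)

subsets : ∀ m → List (Subset m)
subsets = vectors (outside ∷ inside ∷ [])

colorings : ∀ m → List (Coloring m)
colorings = vectors (nothing ∷ just 0F ∷ just 1F ∷ [])

-- The maximum of  f x  over the x in the list that satisfy P, with value 0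
-- if there is no such x (by the lemmas at the end, this never occurs below).
maximum : {A : Set} {P : A → Set} → (A → ℕ) → Decidable P → List A → ℕ
maximum f P? xs = max 0 (map f (filter P? xs))

module _ {n m : ℕ} (G : Graph n m) where

  IsProper : Coloring m → Set
  IsProper f = ∀ i → IsMatching G (class f i)

  isProper? : Decidable IsProper
  isProper? f = all? λ i → isMatching? G (class f i)

  -- λ(G)
  Λ : ℕ
  Λ = maximum size isProper? (colorings m)

  IsMPP : Coloring m → Set
  IsMPP f = IsProper f × size f ≡ Λ

  isMPP? : Decidable IsMPP
  isMPP? f = isProper? f ×-dec (size f ℕₚ.≟ Λ)

  α : ℕ
  α = maximum (λ (i , f) → ∣ class f i ∣) (λ (i , f) → isMPP? f) (cartesianProduct (allFin 2) (colorings m))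

  β : ℕ
  β = maximum ∣_∣ (isMatching? G) (subsets m)

-- The enumerations are exhaustive, so Λ, α and β are maxima over all
-- colorings and matchings.

IsMaximum : {A : Set} → (A → Set) → (A → ℕ) → ℕ → Set
IsMaximum P f k = (∃ λ x → P x × f x ≡ k) × (∀ x → P x → f x ≤ k)

∈-vectors : {A : Set} {xs : List A} → (∀ x → x ∈ˡ xs) → ∀ {m} (v : Vec A m) → v ∈ˡ vectors xs m
∈-vectors all []      = here refl
∈-vectors all (x ∷ v) = ∈-cartesianProductWith⁺ _∷_ (all x) (∈-vectors all v)

∈-subsets : ∀ {m} (p : Subset m) → p ∈ˡ subsets m
∈-subsets = ∈-vectors λ where
  false → here refl
  true  → there (here refl)

∈-colorings : ∀ {m} (f : Coloring m) → f ∈ˡ colorings m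
∈-colorings = ∈-vectors λ where
  nothing   → here refl
  (just 0F) → there (here refl)
  (just 1F) → there (there (here refl))

maximum-isMaximum : {A : Set} {P : A → Set} (f : A → ℕ) (P? : Decidable P) {xs : List A} →
                    (∀ x → x ∈ˡ xs) → ∃ P → IsMaximum P f (maximum f P? xs)
maximum-isMaximum {P = P} f P? {xs} all (x₀ , p₀) = attained (argmax-sel (λ k → k) 0 ys) , upper
  where
  ys = map f (filter P? xs)
  upper : ∀ x → P x → f x ≤ maximum f P? xs
  upper x p = All.lookup (xs≤max 0 ys) (∈-map⁺ f (∈-filter⁺ P? {xs = xs} (all x) p))
  attained : maximum f P? xs ≡ 0 ⊎ maximum f P? xs ∈ˡ ys → ∃ λ x → P x × f x ≡ maximum f P? xs
  attained (inj₁ eq) = x₀ , p₀ , ℕₚ.≤-antisym (upper x₀ p₀) (subst (_≤ f x₀) (sym eq) z≤n)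
  attained (inj₂ k∈) with ∈-map⁻ f k∈
  ... | x , x∈ , eq = x , proj₂ (∈-filter⁻ P? {xs = xs} x∈) , sym eq

class-nothing : ∀ m i → class (replicate m nothing) i ≡ ⊥
class-nothing zero    i = refl
class-nothing (suc m) i rewrite class-nothing m i = refl

module _ {n m : ℕ} (G : Graph n m) where

  ⊥-isMatching : IsMatching G ⊥
  ⊥-isMatching _ _ e∈⊥ = ⊥-elim (∉⊥ e∈⊥)

  Λ-isMaximum : IsMaximum (IsProper G) size (Λ G)
  Λ-isMaximum = maximum-isMaximum size (isProper? G) ∈-colorings
    (replicate m nothing , λ i → subst (IsMatching G) (sym (class-nothing m i)) ⊥-isMatching)

  α-isMaximum : IsMaximum (λ (i , f) → IsMPP G f) (λ (i , f) → ∣ class f i ∣) (α G)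
  α-isMaximum = maximum-isMaximum _ (λ (i , f) → isMPP? G f)
    (λ (i , f) → ∈-cartesianProduct⁺ (∈-allFin i) (∈-colorings f))
    (let (f , proper , eq) , _ = Λ-isMaximum in (0F , f) , proper , eq)

  β-isMaximum : IsMaximum (IsMatching G) ∣_∣ (β G)
  β-isMaximum = maximum-isMaximum ∣_∣ (isMatching? G) ∈-subsets (⊥ , ⊥-isMatching)

{-# OPTIONS --safe #-}
-- Root the tree at an endpoint (anywhere, if there is none).  By hypothesis
-- every vertex of odd depth then has a child, and every edge has exactly one
-- end of odd depth.  Among the MPP colorings take one with as many colored
-- edges as possible whose upper end has odd depth.  If an odd vertex b had no
-- colored edge to a child, pick a child c and a color i missing at b: by
-- maximality of λ there is an edge of color i at c, leading down from c, and
-- moving the color i from it to bc contradicts the choice.  So every odd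
-- vertex has a colored edge to a child.  Swapping the colors on components of
-- the colored edges, from the root downwards, makes every odd vertex meet color
-- 0: a vertex without a colored parent edge is the top of its component, whose
-- colors can be chosen freely, and any other odd vertex meets both colors.
-- Color class 0 then has one edge for each odd vertex, hence is at least as
-- large as any matching.
module Submission where

open import Defs
open import Data.Bool.Base using (true)
open import Data.Fin.Base using (Fin; zero; suc; opposite)
import Data.Fin.Base as Fin
open import Data.Fin.Patterns using (0F; 1F)
open import Data.Fin.Properties using (any?)
  renaming (_≟_ to _≟ᶠ_; <-asym to <ᶠ-asym; <-irrefl to <ᶠ-irrefl; suc-injective to suc-injectiveᶠ)
open import Data.Fin.Subset using (Subset; ∣_∣; _∈_; ⁅_⁆; inside; outside; _-_)
open import Data.Fin.Subset.Properties
  using (∣⁅x⁆∣≡1; x∈⁅x⁆; x∈⁅y⁆⇒x≡y; ⊆-antisym; x∈p∧x≢y⇒x∈p-y; x∈p⇒∣p-x∣<∣p∣)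
open import Data.List.Base using (List; []; _∷_; _∷ʳ_)
open import Data.List.Relation.Unary.All as All using (All; []; _∷_)
import Data.List.Relation.Unary.All.Properties as All
open import Data.List.Relation.Unary.AllPairs using ([]; _∷_)
open import Data.List.Relation.Unary.Unique.Propositional using (Unique)
open import Data.Maybe.Base as Maybe using (just; nothing)
open import Data.Maybe.Properties using (≡-dec)
open import Data.Nat.Base using (ℕ; zero; suc; _+_; _*_; _≤_; _<_; z≤n; s≤s; parity)
open import Data.Nat.Divisibility using (_∣_; divides-refl)
open import Data.Nat.Properties
open import Algebra.Properties.CommutativeSemigroup +-commutativeSemigroup using (x∙yz≈y∙xz)
open import Data.Parity.Base using (0ℙ; 1ℙ; _⁻¹)
open import Data.Parity.Properties using (suc-homo-⁻¹; ⁻¹-involutive)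
open import Data.Product.Base using (∃; _×_; _,_; proj₁; proj₂)
open import Data.Sum.Base using (_⊎_; inj₁; inj₂; [_,_]′; swap)
open import Data.Vec.Base using ([]; _∷_; lookup; tabulate; _[_]≔_; here; there)
open import Data.Vec.Properties
  using (lookup∘tabulate; lookup-map; lookup⇒[]=; []=⇒lookup; lookup∘update; lookup∘update′)
open import Function.Base using (_∘_)
open import Relation.Binary.Construct.Closure.ReflexiveTransitive using (ε; _◅_; _◅◅_)
open import Relation.Binary.Definitions using (tri<; tri≈; tri>)
open import Relation.Binary.PropositionalEquality using (_≡_; _≢_; refl; sym; trans; cong; cong₂; subst; subst₂)
open import Relation.Nullary using (¬_; Dec; yes; no; does; contradiction)
open import Relation.Nullary.Decidable using (_×-dec_; _⊎-dec_; dec-true; map′; decidable-stable)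
open import Relation.Unary using (Decidable)

private variable
  n m k : ℕ

-- Subsets and colorings

-- Pigeonhole, by induction on `p`: each element of `p` uses up its own image, which is removed from
-- `q` before the recursive call.
∣∣-mono-injective : (p : Subset m) (q : Subset k) (φ : Fin m → Fin k) →
                    (∀ {x} → x ∈ p → φ x ∈ q) →
                    (∀ {x y} → x ∈ p → y ∈ p → φ x ≡ φ y → x ≡ y) →
                    ∣ p ∣ ≤ ∣ q ∣
∣∣-mono-injective []            q φ into inj = z≤n
∣∣-mono-injective (outside ∷ p) q φ into inj =
  ∣∣-mono-injective p q (φ ∘ suc) (into ∘ there)
    λ x∈ y∈ eq → suc-injectiveᶠ (inj (there x∈) (there y∈) eq)
∣∣-mono-injective (inside ∷ p)  q φ into inj = ≤-trans
  (s≤s (∣∣-mono-injective p (q - φ zero) (φ ∘ suc)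
    (λ x∈ → x∈p∧x≢y⇒x∈p-y (into (there x∈)) λ eq → contradiction (inj (there x∈) here eq) λ ())
    λ x∈ y∈ eq → suc-injectiveᶠ (inj (there x∈) (there y∈) eq)))
  (x∈p⇒∣p-x∣<∣p∣ (into here))

does-true : {A : Set} (a? : Dec A) → does a? ≡ true → A
does-true (yes a) _ = a

∈-class⁺ : (f : Coloring m) {i : Fin 2} {e : Fin m} → lookup f e ≡ just i → e ∈ class f i
∈-class⁺ f {i} {e} eq = lookup⇒[]= e _ (trans (lookup-map e _ f) (dec-true (≡-dec _≟ᶠ_ (lookup f e) (just i)) eq))

∈-class⁻ : (f : Coloring m) {i : Fin 2} {e : Fin m} → e ∈ class f i → lookup f e ≡ just i
∈-class⁻ f {i} {e} e∈ = does-true (≡-dec _≟ᶠ_ (lookup f e) (just i)) (trans (sym (lookup-map e _ f)) ([]=⇒lookup e∈))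

-- Covers both quantities to be maximized: constant weight 1 gives `size`, and `oddTop` gives the
-- secondary count.
weight : (Fin m → ℕ) → Coloring m → ℕ
weight w []            = 0
weight w (nothing ∷ f) = weight (w ∘ suc) f
weight w (just _ ∷ f)  = w zero + weight (w ∘ suc) f

size≡weight : (f : Coloring m) → size f ≡ weight (λ _ → 1) f
size≡weight []             = refl
size≡weight (nothing ∷ f)  = size≡weight f
size≡weight (just 0F ∷ f)  = cong suc (size≡weight f)
size≡weight (just 1F ∷ f)  = trans (+-suc _ _) (cong suc (size≡weight f))

weight-insert : (w : Fin m → ℕ) (f : Coloring m) (e : Fin m) {i : Fin 2} →
                lookup f e ≡ nothing → weight w (f [ e ]≔ just i) ≡ w e + weight w f
weight-insert w (nothing ∷ f) zero    eq = refl
weight-insert w (nothing ∷ f) (suc e) eq = weight-insert (w ∘ suc) f e eq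
weight-insert w (just _ ∷ f)  (suc e) eq =
  trans (cong (w zero +_) (weight-insert (w ∘ suc) f e eq)) (x∙yz≈y∙xz (w zero) (w (suc e)) _)

weight-delete : (w : Fin m → ℕ) (f : Coloring m) (e : Fin m) {i : Fin 2} →
                lookup f e ≡ just i → weight w f ≡ w e + weight w (f [ e ]≔ nothing)
weight-delete w (just _ ∷ f)  zero    eq = refl
weight-delete w (nothing ∷ f) (suc e) eq = weight-delete (w ∘ suc) f e eq
weight-delete w (just _ ∷ f)  (suc e) eq =
  trans (cong (w zero +_) (weight-delete (w ∘ suc) f e eq)) (x∙yz≈y∙xz (w zero) (w (suc e)) _)

weight-recolor : (w : Fin m → ℕ) (f : Coloring m) (ρ : Fin m → Fin 2 → Fin 2) →
                 weight w (tabulate λ e → Maybe.map (ρ e) (lookup f e)) ≡ weight w f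
weight-recolor w []            ρ = refl
weight-recolor w (nothing ∷ f) ρ = weight-recolor (w ∘ suc) f (ρ ∘ suc)
weight-recolor w (just _ ∷ f)  ρ = cong (w zero +_) (weight-recolor (w ∘ suc) f (ρ ∘ suc))

infixr 6 _⊕_
-- Addition modulo 2 on colors: shifting by `1F` swaps them.
_⊕_ : Fin 2 → Fin 2 → Fin 2
0F ⊕ j = j
1F ⊕ j = opposite j

⊕-injective : ∀ i {j k} → i ⊕ j ≡ i ⊕ k → j ≡ k
⊕-injective 0F              eq = eq
⊕-injective 1F {0F} {0F}    eq = refl
⊕-injective 1F {1F} {1F}    eq = refl
⊕-injective 1F {0F} {1F}    ()
⊕-injective 1F {1F} {0F}    ()

⊕-self : ∀ i → i ⊕ i ≡ 0F
⊕-self 0F = refl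
⊕-self 1F = refl

⊕-meets-0 : ∀ i {j k} → j ≢ k → i ⊕ j ≡ 0F ⊎ i ⊕ k ≡ 0F
⊕-meets-0 0F {0F}      j≢k = inj₁ refl
⊕-meets-0 0F {1F} {0F} j≢k = inj₂ refl
⊕-meets-0 0F {1F} {1F} j≢k = contradiction refl j≢k
⊕-meets-0 1F {1F}      j≢k = inj₁ refl
⊕-meets-0 1F {0F} {1F} j≢k = inj₂ refl
⊕-meets-0 1F {0F} {0F} j≢k = contradiction refl j≢k

parity-suc : ∀ k → parity (suc k) ≡ parity k ⁻¹
parity-suc k = trans (sym (⁻¹-involutive _)) (cong _⁻¹ (suc-homo-⁻¹ k))

2∣⇒even : 2 ∣ k → parity k ≡ 0ℙ
2∣⇒even (divides-refl q) = go q
  where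
  go : ∀ q → parity (q * 2) ≡ 0ℙ
  go zero    = refl
  go (suc q) = go q

-- Proper colorings, vertex by vertex

module _ (G : Graph n m) where
  open Graph G

  matching-unique : ∀ {M v e e′} → IsMatching G M → Incident G v e → Incident G v e′ →
                    e ∈ M → e′ ∈ M → e ≡ e′
  matching-unique {e = e} {e′} matching v∈e v∈e′ e∈ e′∈ with e ≟ᶠ e′
  ... | yes eq = eq
  ... | no  ne = contradiction (share v∈e) (matching e e′ e∈ e′∈ ne)
    where
    share : Incident G _ e → ShareVertex G e e′
    share (inj₁ refl) = inj₁ v∈e′
    share (inj₂ refl) = inj₂ v∈e′

  unique-matching : ∀ {M} → (∀ {v e e′} → Incident G v e → Incident G v e′ → e ∈ M → e′ ∈ M → e ≡ e′) →
                    IsMatching G M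
  unique-matching unique e e′ e∈ e′∈ ne (inj₁ s) = ne (unique (inj₁ refl) s e∈ e′∈)
  unique-matching unique e e′ e∈ e′∈ ne (inj₂ s) = ne (unique (inj₂ refl) s e∈ e′∈)

  Proper : Coloring m → Set
  Proper f = ∀ {i v e e′} → Incident G v e → Incident G v e′ →
             lookup f e ≡ just i → lookup f e′ ≡ just i → e ≡ e′

  isProper⇒proper : ∀ f → IsProper G f → Proper f
  isProper⇒proper f proper v∈e v∈e′ eq eq′ =
    matching-unique (proper _) v∈e v∈e′ (∈-class⁺ f eq) (∈-class⁺ f eq′)

  proper⇒isProper : ∀ f → Proper f → IsProper G f
  proper⇒isProper f proper i = unique-matching λ v∈e v∈e′ e∈ e′∈ →
    proper v∈e v∈e′ (∈-class⁻ f e∈) (∈-class⁻ f e′∈)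

  lookup-delete : ∀ (f : Coloring m) e {e′ i} → lookup (f [ e ]≔ nothing) e′ ≡ just i → e′ ≢ e × lookup f e′ ≡ just i
  lookup-delete f e {e′} eq with e′ ≟ᶠ e
  ... | yes refl = contradiction (trans (sym eq) (lookup∘update e f nothing)) λ ()
  ... | no  ne   = ne , trans (sym (lookup∘update′ ne f nothing)) eq

  delete-proper : ∀ f e → Proper f → Proper (f [ e ]≔ nothing)
  delete-proper f e proper v∈e v∈e′ eq eq′ =
    proper v∈e v∈e′ (proj₂ (lookup-delete f e eq)) (proj₂ (lookup-delete f e eq′))

  insert-proper : ∀ f e i → Proper f →
                  (∀ {v e′} → Incident G v e → Incident G v e′ → lookup f e′ ≢ just i) →
                  Proper (f [ e ]≔ just i)
  insert-proper f e i proper free {j} {v} {e₁} {e₂} v∈e₁ v∈e₂ eq₁ eq₂ with e₁ ≟ᶠ e | e₂ ≟ᶠ e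
  ... | yes refl | yes refl = refl
  ... | no ne₁   | no ne₂   = proper v∈e₁ v∈e₂ (trans (sym (lookup∘update′ ne₁ f _)) eq₁)
                                               (trans (sym (lookup∘update′ ne₂ f _)) eq₂)
  ... | yes refl | no ne₂   with refl ← trans (sym (lookup∘update e f _)) eq₁ =
    contradiction (trans (sym (lookup∘update′ ne₂ f _)) eq₂) (free v∈e₁ v∈e₂)
  ... | no ne₁   | yes refl with refl ← trans (sym (lookup∘update e f _)) eq₂ =
    contradiction (trans (sym (lookup∘update′ ne₁ f _)) eq₁) (free v∈e₂ v∈e₁)

-- Edges of a rooted tree run from  top  down to  bot.
record Rooting (G : Graph n m) : Set where
  field
    top bot       : Fin m → Fin n
    depth         : Fin n → ℕ
    top-incident  : ∀ e → Incident G (top e) e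
    bot-incident  : ∀ e → Incident G (bot e) e
    incident      : ∀ {v e} → Incident G v e → v ≡ top e ⊎ v ≡ bot e
    depth-bot     : ∀ e → depth (bot e) ≡ suc (depth (top e))
    -- Uniqueness of the parent edge; this and `depth-bot` are what acyclicity of the tree provides.
    bot-injective : ∀ {e e′} → bot e ≡ bot e′ → e ≡ e′

  Odd : Fin n → Set
  Odd v = parity (depth v) ≡ 1ℙ

  field
    -- The form in which the parity hypothesis on endpoints reaches the coloring argument.
    odd⇒child     : ∀ {v} → Odd v → ∃ λ e → top e ≡ v

-- Exchanging edges in maximum colorings of a rooted tree

module _ {G : Graph n m} (R : Rooting G) where
  open Rooting R

  parity-bot : ∀ e → parity (depth (bot e)) ≡ parity (depth (top e)) ⁻¹
  parity-bot e = trans (cong parity (depth-bot e)) (parity-suc (depth (top e)))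

  colored? : (f : Coloring m) (P : Fin m → Set) → Decidable P → Dec (∃ λ e → P e × ∃ λ i → lookup f e ≡ just i)
  colored? f P P? = any? λ e → P? e ×-dec any? λ i → ≡-dec _≟ᶠ_ (lookup f e) (just i)

  ParentColored ChildColored : Coloring m → Fin n → Set
  ParentColored f v = ∃ λ e → bot e ≡ v × ∃ λ i → lookup f e ≡ just i
  ChildColored  f v = ∃ λ e → top e ≡ v × ∃ λ i → lookup f e ≡ just i

  parentColored? : ∀ f v → Dec (ParentColored f v)
  parentColored? f v = colored? f _ λ e → bot e ≟ᶠ v

  childColored? : ∀ f v → Dec (ChildColored f v)
  childColored? f v = colored? f _ λ e → top e ≟ᶠ v

  oddTop : Fin m → ℕ
  oddTop e with parity (depth (top e))
  ... | 0ℙ = 0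
  ... | 1ℙ = 1

  oddTop-odd : ∀ e → Odd (top e) → oddTop e ≡ 1
  oddTop-odd e odd with parity (depth (top e))
  ... | 1ℙ = refl

  oddTop-even : ∀ e → parity (depth (top e)) ≡ 0ℙ → oddTop e ≡ 0
  oddTop-even e even with parity (depth (top e))
  ... | 0ℙ = refl

  -- Only the parent edge can be colored at such a `v`, and it uses at most one of the two colors.
  missing-color : ∀ f v → ¬ ChildColored f v → ∃ λ i → ∀ {e} → Incident G v e → lookup f e ≢ just i
  missing-color f v ¬child with any? (λ e → bot e ≟ᶠ v ×-dec ≡-dec _≟ᶠ_ (lookup f e) (just 0F))
  ... | no ¬0 = 0F , λ v∈e eq → case (incident v∈e) eq
    where
    case : ∀ {e} → v ≡ top e ⊎ v ≡ bot e → lookup f e ≢ just 0F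
    case (inj₁ v≡) eq = ¬child (_ , sym v≡ , 0F , eq)
    case (inj₂ v≡) eq = ¬0 (_ , sym v≡ , eq)
  ... | yes (e₀ , refl , eq₀) = 1F , λ v∈e eq → case (incident v∈e) eq
    where
    case : ∀ {e} → bot e₀ ≡ top e ⊎ bot e₀ ≡ bot e → lookup f e ≢ just 1F
    case (inj₁ v≡) eq = ¬child (_ , sym v≡ , 1F , eq)
    case (inj₂ v≡) eq with refl ← bot-injective v≡ = contradiction (trans (sym eq₀) eq) λ ()

  exchange : ∀ f {v} → Proper G f → (∀ f′ → Proper G f′ → size f′ ≤ size f) → Odd v → ¬ ChildColored f v →
             ∃ λ f′ → Proper G f′ × size f′ ≡ size f × weight oddTop f < weight oddTop f′
  exchange f {v} proper largest odd ¬child with odd⇒child odd | missing-color f v ¬child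
  ... | e , refl | i , free with lookup f e in fe
  ...   | just j  = contradiction (e , refl , j , fe) ¬child
  ...   | nothing with any? (λ e₁ → incident? G (bot e) e₁ ×-dec ≡-dec _≟ᶠ_ (lookup f e₁) (just i))
  -- If `i` were missing at the lower end of `e` too, `e` could be colored in addition, against
  -- `largest`.
  ...     | no ¬blocked = contradiction (subst (_≤ size f) size-larger (largest (f [ e ]≔ just i) larger)) (n≮n (size f))
    where
    larger : Proper G (f [ e ]≔ just i)
    larger = insert-proper G f e i proper λ v∈e v∈e′ eq → case (incident v∈e) v∈e′ eq
      where
      case : ∀ {v e′} → v ≡ top e ⊎ v ≡ bot e → Incident G v e′ → lookup f e′ ≢ just i
      case (inj₁ refl) v∈e′ eq = free v∈e′ eq
      case (inj₂ refl) v∈e′ eq = ¬blocked (_ , v∈e′ , eq)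
    size-larger : size (f [ e ]≔ just i) ≡ suc (size f)
    size-larger = trans (size≡weight (f [ e ]≔ just i)) (trans (weight-insert _ f e fe) (cong suc (sym (size≡weight f))))
  ...     | yes (e₁ , c∈e₁ , fe₁) = f′ , proper′ , size′ , ≤-reflexive (sym gain)
    where
    e≢e₁ : e ≢ e₁
    e≢e₁ refl = contradiction (trans (sym fe) fe₁) λ ()

    -- The only edge leading up from `bot e` is the uncolored `e`, so the blocking edge leads down,
    -- from a vertex of even depth.
    top-e₁ : bot e ≡ top e₁
    top-e₁ with incident c∈e₁
    ... | inj₁ eq = eq
    ... | inj₂ eq = contradiction (bot-injective eq) e≢e₁

    even-e₁ : parity (depth (top e₁)) ≡ 0ℙ
    even-e₁ = trans (cong (parity ∘ depth) (sym top-e₁))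
              (trans (parity-bot e) (cong _⁻¹ odd))

    f₀ f′ : Coloring m
    f₀ = f [ e₁ ]≔ nothing
    f′ = f₀ [ e ]≔ just i

    f₀e : lookup f₀ e ≡ nothing
    f₀e = trans (lookup∘update′ e≢e₁ f nothing) fe

    proper′ : Proper G f′
    proper′ = insert-proper G f₀ e i (delete-proper G f e₁ proper) λ v∈e v∈e′ eq →
      case (incident v∈e) v∈e′ (lookup-delete G f e₁ eq)
      where
      case : ∀ {v e′} → v ≡ top e ⊎ v ≡ bot e → Incident G v e′ → ¬ (e′ ≢ e₁ × lookup f e′ ≡ just i)
      case (inj₁ refl) v∈e′ (_ , eq)  = free v∈e′ eq
      -- At `bot e` the deleted `e₁` was the only edge of color `i`.
      case (inj₂ refl) v∈e′ (ne , eq) = ne (proper v∈e′ c∈e₁ eq fe₁)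

    size′ : size f′ ≡ size f
    size′ = trans (size≡weight f′) (trans (weight-insert _ f₀ e f₀e)
            (trans (sym (weight-delete _ f e₁ fe₁)) (sym (size≡weight f))))

    -- The inserted `e` counts 1, the deleted `e₁` counted 0.
    gain : weight oddTop f′ ≡ suc (weight oddTop f)
    gain = trans (weight-insert oddTop f₀ e f₀e) (cong₂ _+_ (oddTop-odd e odd)
           (sym (trans (weight-delete oddTop f e₁ fe₁) (cong (_+ weight oddTop f₀) (oddTop-even e₁ even-e₁)))))

  MPP-with-colored-children : ∃ λ f → IsMPP G f × ∀ {v} → Odd v → ChildColored f v
  MPP-with-colored-children =
    let (f , (isProper , size-f) , eq) , upper =
          -- A second maximization, over MPP colorings only; the maximum defining `Λ` is attained,
          -- so there is one.
          maximum-isMaximum (weight oddTop) (isMPP? G) ∈-colorings (Λ-isMaximum G .proj₁)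
        largest : ∀ f′ → Proper G f′ → size f′ ≤ size f
        largest f′ proper′ = subst (size f′ ≤_) (sym size-f) (proj₂ (Λ-isMaximum G) f′ (proper⇒isProper G f′ proper′))
    in f , (isProper , size-f) , λ {v} odd → decidable-stable (childColored? f v) λ ¬child →
       let f′ , proper′ , size′ , gain = exchange f (isProper⇒proper G f isProper) largest odd ¬child
       in <⇒≱ gain (subst (weight oddTop f′ ≤_) (sym eq) (upper f′ (proper⇒isProper G f′ proper′ , trans size′ size-f)))

  -- Swapping colors on components of the colored edges

  module Recolor (f : Coloring m) (proper : Proper G f) (children : ∀ {v} → Odd v → ChildColored f v) where

    -- Shifting by the color of a child edge gives that edge color 0. A component top without such
    -- an edge meets no colored edge, so there the value is arbitrary.
    start : ∀ v → Dec (ChildColored f v) → Fin 2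
    start v (yes (_ , _ , i , _)) = i
    start v (no _)                = 0F

    -- The first argument is the depth of the vertex, for structural recursion.
    shift : ℕ → Fin n → Fin 2
    next  : ℕ → ∀ v → Dec (ParentColored f v) → Fin 2
    shift zero    v = start v (childColored? f v)
    shift (suc d) v = next d v (parentColored? f v)
    next d v (yes (e , _)) = shift d (top e)
    next d v (no _)        = start v (childColored? f v)

    -- One shift per component: inherited across a colored parent edge, and chosen by `start` where
    -- there is none.
    σ : Fin n → Fin 2
    σ v = shift (depth v) v

    -- Rewriting the depth as a successor lets `shift` unfold once; the colored parent edge it finds
    -- must be `e` itself.
    σ-colored : ∀ {e i} → lookup f e ≡ just i → σ (bot e) ≡ σ (top e)
    σ-colored {e} {i} eq rewrite depth-bot e with parentColored? f (bot e)
    ... | yes (e′ , bot≡ , _) = cong (shift (depth (top e)) ∘ top) (bot-injective bot≡)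
    ... | no ¬parent          = contradiction (e , refl , i , eq) ¬parent

    σ-component-top : ∀ {v} → ¬ ParentColored f v → σ v ≡ start v (childColored? f v)
    σ-component-top {v} ¬parent with depth v
    ... | zero  = refl
    ... | suc d with parentColored? f v
    ...   | yes parent = contradiction parent ¬parent
    ...   | no  _      = refl

    g : Coloring m
    g = tabulate λ e → Maybe.map (σ (top e) ⊕_) (lookup f e)

    σ-top : ∀ {v e i} → Incident G v e → lookup f e ≡ just i → σ (top e) ≡ σ v
    σ-top v∈e eq with incident v∈e
    ... | inj₁ refl = refl
    ... | inj₂ refl = sym (σ-colored eq)

    lookup-g⁺ : ∀ {v e i} → Incident G v e → lookup f e ≡ just i → lookup g e ≡ just (σ v ⊕ i)
    lookup-g⁺ {e = e} {i} v∈e eq = trans (lookup∘tabulate _ e)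
      (trans (cong (Maybe.map (σ (top e) ⊕_)) eq) (cong (λ s → just (s ⊕ i)) (σ-top v∈e eq)))

    lookup-g⁻ : ∀ {v e i} → Incident G v e → lookup g e ≡ just i → ∃ λ j → lookup f e ≡ just j × i ≡ σ v ⊕ j
    lookup-g⁻ {e = e} v∈e eq with lookup f e in fe | trans (sym (lookup∘tabulate _ e)) eq
    ... | just j | refl = j , refl , cong (_⊕ j) (σ-top v∈e fe)

    -- All colored edges at `v` are shifted by the same `σ v`, so edges with equal new colors had
    -- equal old colors.
    g-proper : Proper G g
    g-proper {v = v} v∈e v∈e′ eq eq′ with lookup-g⁻ v∈e eq | lookup-g⁻ v∈e′ eq′
    ... | j , fe , i≡ | j′ , fe′ , i≡′ with refl ← ⊕-injective (σ v) (trans (sym i≡) i≡′) =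
      proper v∈e v∈e′ fe fe′

    g-size : size g ≡ size f
    g-size = trans (size≡weight g) (trans (weight-recolor _ f _) (sym (size≡weight f)))

    meets-0 : ∀ {v} → Odd v → ∃ λ e → Incident G v e × lookup g e ≡ just 0F
    meets-0 {v} odd = decide (parentColored? f v)
      where
      decide : Dec (ParentColored f v) → ∃ λ e → Incident G v e × lookup g e ≡ just 0F
      decide (no ¬parent) with childColored? f v in dec
      ... | no ¬child               = contradiction (children odd) ¬child
      ... | yes (e , refl , i , eq) = e , top-incident e , trans (lookup-g⁺ (top-incident e) eq)
        (cong just (trans (cong (_⊕ i) (trans (σ-component-top ¬parent) (cong (start v) dec))) (⊕-self i)))
      decide (yes (e , refl , i , eq)) with children odd
      ... | e′ , top≡ , j , eq′ = [ (λ 0≡ → e , v∈e , trans (lookup-g⁺ v∈e eq) (cong just 0≡))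
                                  , (λ 0≡ → e′ , v∈e′ , trans (lookup-g⁺ v∈e′ eq′) (cong just 0≡))
                                  ]′ (⊕-meets-0 (σ v) i≢j)
        where
        v∈e : Incident G v e
        v∈e = bot-incident e
        v∈e′ : Incident G v e′
        v∈e′ = subst (λ v → Incident G v e′) top≡ (top-incident e′)
        -- Equal colors would make the parent edge and the child edge one edge, placing `v` one
        -- level below itself.
        i≢j : i ≢ j
        i≢j refl with refl ← proper v∈e v∈e′ eq eq′ = 1+n≢n (trans (sym (depth-bot e)) (sym (cong depth top≡)))

  -- Comparing a matching with a color class

  odd-end : ∀ e → ∃ λ v → Odd v × Incident G v e
  odd-end e with parity (depth (top e)) in eq
  ... | 1ℙ = top e , eq , top-incident e
  ... | 0ℙ = bot e , trans (parity-bot e) (cong _⁻¹ eq) , bot-incident e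

  odd-end-unique : ∀ {e u v} → Odd u → Odd v → Incident G u e → Incident G v e → u ≡ v
  odd-end-unique {e} odd-u odd-v u∈e v∈e with incident u∈e | incident v∈e
  ... | inj₁ refl | inj₁ refl = refl
  ... | inj₂ refl | inj₂ refl = refl
  ... | inj₁ refl | inj₂ refl = contradiction (trans (sym odd-v) (trans (parity-bot e) (cong _⁻¹ odd-u))) λ ()
  ... | inj₂ refl | inj₁ refl = contradiction (trans (sym odd-u) (trans (parity-bot e) (cong _⁻¹ odd-v))) λ ()

  -- Send an edge of `M` to an edge of color `i` at its odd end. The image has only one odd end,
  -- which it therefore determines, and `M` has at most one edge there.
  matching≤class : ∀ {M i} (f : Coloring m) → (∀ {v} → Odd v → ∃ λ e → Incident G v e × lookup f e ≡ just i) →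
                   IsMatching G M → ∣ M ∣ ≤ ∣ class f i ∣
  matching≤class {M} {i} f meets matching = ∣∣-mono-injective M (class f i) φ (λ {e} _ → ∈-class⁺ f (φ-color e)) φ-injective
    where
    end : Fin m → Fin n
    end e = odd-end e .proj₁
    end-odd : ∀ e → Odd (end e)
    end-odd e = odd-end e .proj₂ .proj₁
    φ : Fin m → Fin m
    φ e = meets (end-odd e) .proj₁
    φ-color : ∀ e → lookup f (φ e) ≡ just i
    φ-color e = meets (end-odd e) .proj₂ .proj₂
    φ-injective : ∀ {e e′} → e ∈ M → e′ ∈ M → φ e ≡ φ e′ → e ≡ e′
    φ-injective {e} {e′} e∈ e′∈ eq = matching-unique G matching
      (subst (λ v → Incident G v e) ends≡ (odd-end e .proj₂ .proj₂)) (odd-end e′ .proj₂ .proj₂) e∈ e′∈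
      where
      ends≡ : end e ≡ end e′
      ends≡ = odd-end-unique (end-odd e) (end-odd e′) (meets (end-odd e) .proj₂ .proj₁)
        (subst (Incident G (end e′)) (sym eq) (meets (end-odd e′) .proj₂ .proj₁))

  -- One inequality holds since color classes are matchings; the other compares a maximum matching
  -- with class 0 of the recolored `g`, still an MPP coloring.
  α≡β : α G ≡ β G
  α≡β = ≤-antisym α≤β β≤α
    where
    α≤β : α G ≤ β G
    α≤β = let ((i , f) , (isProper , _) , eq) , _ = α-isMaximum G in
      subst (_≤ β G) eq (proj₂ (β-isMaximum G) (class f i) (isProper i))

    β≤α : β G ≤ α G
    β≤α =
      let (M , matching , eq) , _         = β-isMaximum G
          f , (isProper , size-f) , children = MPP-with-colored-children
          open Recolor f (isProper⇒proper G f isProper) children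
      in subst (_≤ α G) eq (≤-trans (matching≤class g meets-0 matching)
           (proj₂ (α-isMaximum G) (0F , g) (proper⇒isProper G g g-proper , trans g-size size-f)))

-- Rooting a tree by distance

least : {P : ℕ → Set} → Decidable P → ∃ P → ∃ λ d → P d × ∀ j → P j → d ≤ j
least {P} P? (k , p) = go P? k p
  where
  go : {P : ℕ → Set} → Decidable P → ∀ k → P k → ∃ λ d → P d × ∀ j → P j → d ≤ j
  go P? k p with P? 0
  go P? k p       | yes p₀ = 0 , p₀ , λ _ _ → z≤n
  go P? zero p    | no ¬p₀ = contradiction p ¬p₀
  go P? (suc k) p | no ¬p₀ with go (P? ∘ suc) k p
  ... | d , q , lower = suc d , q , λ where
    zero    p₀ → contradiction p₀ ¬p₀
    (suc j) q′ → s≤s (lower j q′)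

-- Walks, distances and degrees

module _ (G : Graph n m) where
  open Graph G

  adjacent-sym : ∀ {u v} → Adjacent G u v → Adjacent G v u
  adjacent-sym (e , j) = e , swap j

  adjacent-irrefl : ∀ {u v} → Adjacent G u v → u ≢ v
  adjacent-irrefl (e , inj₁ (refl , eq)) refl = <ᶠ-irrefl (sym eq) (lo<hi e)
  adjacent-irrefl (e , inj₂ (refl , eq)) refl = <ᶠ-irrefl (sym eq) (lo<hi e)

  adjacent? : ∀ u v → Dec (Adjacent G u v)
  adjacent? u v = any? λ e → (lo e ≟ᶠ u ×-dec hi e ≟ᶠ v) ⊎-dec (lo e ≟ᶠ v ×-dec hi e ≟ᶠ u)

  -- Fixing the length makes existence of a walk decidable, so `least` can find the distance.
  WalkOfLength : Fin n → Fin n → ℕ → Set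
  WalkOfLength u v k = ∃ λ (w : Walk G u v) → length G w ≡ k

  walkOfLength? : ∀ u v → Decidable (WalkOfLength u v)
  walkOfLength? u v zero    = map′ (λ { refl → ε , refl }) (λ { (ε , refl) → refl }) (u ≟ᶠ v)
  walkOfLength? u v (suc k) = map′ (λ { (x , a , w , eq) → a ◅ w , cong suc eq })
                                   (λ { (a ◅ w , eq) → _ , a , w , suc-injective eq })
                                   (any? λ x → adjacent? u x ×-dec walkOfLength? x v k)

  distance : ∀ {u v} → Walk G u v → ∃ (IsDistance G u v)
  distance {u} {v} w with least (walkOfLength? u v) (length G w , w , refl)
  ... | d , attained , lower = d , attained , λ w′ → lower _ (w′ , refl)

  vertices : ∀ {u v} → Walk G u v → List (Fin n)
  vertices {v = v} w = sources G w ∷ʳ v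

  -- Used to close a path into a cycle: distinctness of its vertices becomes the condition in
  -- `IsCycle`.
  sources-snoc : ∀ {u v x} (w : Walk G u v) (a : Adjacent G v x) → sources G (w ◅◅ (a ◅ ε)) ≡ vertices w
  sources-snoc ε       a = refl
  sources-snoc (b ◅ w) a = cong (_ ∷_) (sources-snoc w a)

  length-snoc : ∀ {u v x} (w : Walk G u v) (a : Adjacent G v x) → length G (w ◅◅ (a ◅ ε)) ≡ suc (length G w)
  length-snoc ε       a = refl
  length-snoc (b ◅ w) a = cong suc (length-snoc w a)

  degree-one : ∀ {v e} → Incident G v e → (∀ {e′} → Incident G v e′ → e′ ≡ e) → Endpoint G v
  degree-one {v} {e} v∈e only = trans (cong ∣_∣ (⊆-antisym sub sup)) (∣⁅x⁆∣≡1 e)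
    where
    star : Subset m
    star = tabulate (does ∘ incident? G v)
    sub : ∀ {x} → x ∈ star → x ∈ ⁅ e ⁆
    sub {x} x∈ = subst (_∈ ⁅ e ⁆) (sym (only v∈x)) (x∈⁅x⁆ e)
      where
      v∈x : Incident G v x
      v∈x = does-true (incident? G v x) (trans (sym (lookup∘tabulate (does ∘ incident? G v) x)) ([]=⇒lookup x∈))
    sup : ∀ {x} → x ∈ ⁅ e ⁆ → x ∈ star
    sup x∈ with refl ← x∈⁅y⁆⇒x≡y e x∈ = lookup⇒[]= e star (trans (lookup∘tabulate _ e) (dec-true (incident? G v e) v∈e))

  -- Depth in a tree, and the orientation of its edges

  module Rooted (tree : IsTree G) {r : Fin n}
                (depth : Fin n → ℕ) (depth-isDistance : ∀ v → IsDistance G v r (depth v)) where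
    open IsTree tree using (acyclic)

    depth-adjacent : ∀ {u v} → Adjacent G u v → depth u ≤ suc (depth v)
    depth-adjacent {u} {v} a with depth-isDistance v
    ... | (w , eq) , _ = subst (λ d → depth u ≤ suc d) eq (depth-isDistance u .proj₂ (a ◅ w))

    depth≡0 : ∀ {v} → depth v ≡ 0 → v ≡ r
    depth≡0 {v} d≡ with depth-isDistance v
    ... | (ε , _) , _       = refl
    ... | (_ ◅ _ , eq) , _ = contradiction (trans eq d≡) λ ()

    -- The second vertex of a shortest walk to the root.
    parent : ∀ {v d} → depth v ≡ suc d → ∃ λ u → Adjacent G v u × depth u ≡ d
    parent {v} {d} d≡ with depth-isDistance v
    ... | (ε , eq) , _     = contradiction (trans eq d≡) λ ()
    ... | (a ◅ w , eq) , _ = _ , a , ≤-antisym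
      (subst (depth _ ≤_) (suc-injective (trans eq d≡)) (depth-isDistance _ .proj₂ w))
      (≤-pred (subst (_≤ suc (depth _)) d≡ (depth-adjacent a)))

    -- The depth bound allows extension by deeper vertices without repetition; length at least 2
    -- ensures that one closing edge gives a cycle.
    PathUpTo : ℕ → Fin n → Fin n → Set
    PathUpTo d u v = ∃ λ (w : Walk G u v) →
      Unique (vertices w) × All (λ x → depth x ≤ d) (vertices w) × 2 ≤ length G w

    unique-∷ʳ : ∀ {xs : List (Fin n)} {x} → Unique xs → All (_≢ x) xs → Unique (xs ∷ʳ x)
    unique-∷ʳ []         []         = [] ∷ []
    unique-∷ʳ (px ∷ pxs) (qx ∷ qxs) = All.∷ʳ⁺ px qx ∷ unique-∷ʳ pxs qxs

    -- Follow parents from both vertices until the two ascents meet.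
    level-path : ∀ d {u v} → depth u ≡ d → depth v ≡ d → u ≢ v → PathUpTo d u v
    level-path zero    du dv u≢v = contradiction (trans (depth≡0 du) (sym (depth≡0 dv))) u≢v
    level-path (suc d) {u} {v} du dv u≢v with parent du | parent dv
    ... | u′ , a , du′ | v′ , b , dv′ with u′ ≟ᶠ v′
    ...   | yes refl = a ◅ adjacent-sym b ◅ ε ,
                       (adjacent-irrefl a ∷ u≢v ∷ []) ∷ ((adjacent-irrefl b ∘ sym) ∷ []) ∷ [] ∷ [] ,
                       (≤-reflexive du ∷ m≤n⇒m≤1+n (≤-reflexive du′) ∷ ≤-reflexive dv ∷ []) , s≤s (s≤s z≤n)
    ...   | no u′≢v′ with level-path d du′ dv′ u′≢v′
    ...     | w , unique , below , long = a ◅ (w ◅◅ (b′ ◅ ε)) ,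
      subst (λ xs → Unique (u ∷ xs ∷ʳ v)) (sym eq)
        (All.∷ʳ⁺ (All.map (λ x≤d → above du x≤d ∘ sym) below) u≢v ∷ unique-∷ʳ unique (All.map (above dv) below)) ,
      subst (λ xs → All (λ x → depth x ≤ suc d) (u ∷ xs ∷ʳ v)) (sym eq)
        (≤-reflexive du ∷ All.∷ʳ⁺ (All.map m≤n⇒m≤1+n below) (≤-reflexive dv)) ,
      s≤s (subst (1 ≤_) (sym (length-snoc w b′)) (s≤s z≤n))
      where
      b′ = adjacent-sym b
      eq = sources-snoc w b′
      above : ∀ {x y} → depth y ≡ suc d → depth x ≤ d → x ≢ y
      above dy x≤d refl = <⇒≱ (n<1+n d) (subst (_≤ d) dy x≤d)

    -- Such an edge would close the path from `level-path` into a cycle.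
    no-level-edge : ∀ {u v} → Adjacent G u v → depth u ≢ depth v
    no-level-edge a du≡dv with level-path _ du≡dv refl (adjacent-irrefl a)
    ... | w , unique , _ , long = acyclic (w ◅◅ (a′ ◅ ε))
      (subst (3 ≤_) (sym (length-snoc w a′)) (s≤s long) , subst Unique (sym (sources-snoc w a′)) unique)
      where a′ = adjacent-sym a

    -- Two parents would be joined by a path at depth at most `d`, which avoids `x` and closes
    -- through `x` into a cycle.
    parent-unique : ∀ {x u v d} → depth x ≡ suc d → Adjacent G x u → Adjacent G x v →
                    depth u ≡ d → depth v ≡ d → u ≡ v
    parent-unique {x} {u} {v} {d} dx a b du dv with u ≟ᶠ v
    ... | yes eq = eq
    ... | no u≢v with level-path d du dv u≢v
    ...   | w , unique , below , long = contradiction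
      ( s≤s (subst (2 ≤_) (sym (length-snoc w b′)) (m≤n⇒m≤1+n long))
      , subst (All (x ≢_)) (sym eq) (All.map above below) ∷ subst Unique (sym eq) unique)
      (acyclic (a ◅ (w ◅◅ (b′ ◅ ε))))
      where
      b′ = adjacent-sym b
      eq = sources-snoc w b′
      above : ∀ {y} → depth y ≤ d → x ≢ y
      above y≤d refl = <⇒≱ (n<1+n d) (subst (_≤ d) dx y≤d)

    Joins : Fin m → Fin n → Fin n → Set
    Joins e u v = (lo e ≡ u × hi e ≡ v) ⊎ (lo e ≡ v × hi e ≡ u)

    joins-injective : ∀ {e e′ u v} → Joins e u v → Joins e′ u v → e ≡ e′
    joins-injective (inj₁ (refl , refl)) (inj₁ (p , q)) = sym (injective p q)
    joins-injective (inj₂ (refl , refl)) (inj₂ (p , q)) = sym (injective p q)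
    joins-injective {e} {e′} (inj₁ (refl , refl)) (inj₂ (p , q)) =
      contradiction (subst₂ Fin._<_ p q (lo<hi e′)) (<ᶠ-asym (lo<hi e))
    joins-injective {e} {e′} (inj₂ (refl , refl)) (inj₁ (p , q)) =
      contradiction (subst₂ Fin._<_ p q (lo<hi e′)) (<ᶠ-asym (lo<hi e))

    -- Depths of adjacent vertices differ by at most one, and they are never equal.
    orient : ∀ e → ∃ λ u → ∃ λ v → Joins e u v × depth v ≡ suc (depth u)
    orient e with <-cmp (depth (lo e)) (depth (hi e))
    ... | tri< l<h _ _ = lo e , hi e , inj₁ (refl , refl) , ≤-antisym (depth-adjacent (e , inj₂ (refl , refl))) l<h
    ... | tri≈ _ l≡h _ = contradiction l≡h (no-level-edge (e , inj₁ (refl , refl)))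
    ... | tri> _ _ h<l = hi e , lo e , inj₂ (refl , refl) , ≤-antisym (depth-adjacent (e , inj₁ (refl , refl))) h<l

    rooting : (∀ v → Endpoint G v → parity (depth v) ≡ 0ℙ) → Rooting G
    rooting even-endpoints = record
      { top           = top
      ; bot           = bot
      ; depth         = depth
      ; top-incident  = top-incident
      ; bot-incident  = bot-incident
      ; incident      = incident
      ; depth-bot     = depth-bot
      ; bot-injective = bot-injective
      ; odd⇒child     = odd⇒child
      }
      where
      top bot : Fin m → Fin n
      top e = orient e .proj₁
      bot e = orient e .proj₂ .proj₁

      joins : ∀ e → Joins e (top e) (bot e)
      joins e = orient e .proj₂ .proj₂ .proj₁

      depth-bot : ∀ e → depth (bot e) ≡ suc (depth (top e))
      depth-bot e = orient e .proj₂ .proj₂ .proj₂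

      top-incident : ∀ e → Incident G (top e) e
      top-incident e = [ inj₁ ∘ sym ∘ proj₁ , inj₂ ∘ sym ∘ proj₂ ]′ (joins e)

      bot-incident : ∀ e → Incident G (bot e) e
      bot-incident e = [ inj₂ ∘ sym ∘ proj₂ , inj₁ ∘ sym ∘ proj₁ ]′ (joins e)

      incident : ∀ {v e} → Incident G v e → v ≡ top e ⊎ v ≡ bot e
      incident {e = e} (inj₁ refl) = [ inj₁ ∘ proj₁ , inj₂ ∘ proj₁ ]′ (joins e)
      incident {e = e} (inj₂ refl) = [ inj₂ ∘ proj₂ , inj₁ ∘ proj₂ ]′ (joins e)

      bot-injective : ∀ {e e′} → bot e ≡ bot e′ → e ≡ e′
      bot-injective {e} {e′} eq = joins-injective (subst₂ (Joins e) tops eq (joins e)) (joins e′)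
        where
        tops : top e ≡ top e′
        tops = parent-unique (depth-bot e′) (e , subst (λ v → Joins e v (top e)) eq (swap (joins e))) (e′ , swap (joins e′))
          (suc-injective (trans (sym (depth-bot e)) (trans (cong depth eq) (depth-bot e′)))) refl

      -- Every edge at a childless `v` is its unique parent edge, so `v` would be an endpoint of odd
      -- depth.
      odd⇒child : ∀ {v} → parity (depth v) ≡ 1ℙ → ∃ λ e → top e ≡ v
      odd⇒child {v} odd with any? (λ e → top e ≟ᶠ v)
      ... | yes child  = child
      ... | no ¬child with depth v in dv
      ...   | suc d with parent dv
      ...     | u , (e , j) , _ = contradiction (trans (sym odd) (subst (λ k → parity k ≡ 0ℙ) dv (even-endpoints v endpoint))) λ ()
        where
        v∈ : ∀ {u} → Joins e v u → Incident G v e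
        v∈ (inj₁ (eq , _)) = inj₁ (sym eq)
        v∈ (inj₂ (_ , eq)) = inj₂ (sym eq)
        lower : ∀ {e} → Incident G v e → v ≡ bot e
        lower v∈e with incident v∈e
        ... | inj₁ eq = contradiction (_ , sym eq) ¬child
        ... | inj₂ eq = eq
        endpoint : Endpoint G v
        endpoint = degree-one (v∈ j) λ v∈e′ → bot-injective (trans (sym (lower v∈e′)) (lower (v∈ j)))

mainTheorem1 : ∀ {n m : ℕ} (G : Graph n m) → IsTree G →
    (∀ u v → Endpoint G u → Endpoint G v → ∀ d → IsDistance G u v d → 2 ∣ d) →
    α G ≡ β G
mainTheorem1 G tree even = root-at-endpoint (any? λ v → degree G v ≟ 1)
  where
  open IsTree tree

  -- With `r` as root, distances to `r` are depths, so all endpoints have even depth, as `rooting`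
  -- requires.
  equality-from : ∀ r → (∀ v → Endpoint G v → ∀ d → IsDistance G v r d → 2 ∣ d) → α G ≡ β G
  equality-from r even-from = α≡β (Rooted.rooting G tree depth depth-isDistance λ v endpoint →
    2∣⇒even (even-from v endpoint (depth v) (depth-isDistance v)))
    where
    depth            = λ v → distance G (connected v r) .proj₁
    depth-isDistance = λ v → distance G (connected v r) .proj₂

  root-at-endpoint : Dec (∃ (Endpoint G)) → α G ≡ β G
  root-at-endpoint (yes (r , endpoint)) = equality-from r λ v endpoint′ → even v r endpoint′ endpoint
  -- Without endpoints the parity condition is vacuous, so any vertex can be the root.
  root-at-endpoint (no ¬endpoint)       = equality-from (Fin.fromℕ< nonempty)
    λ v endpoint → contradiction (v , endpoint) ¬endpoint
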